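{- Let $k$ be a positive integer and $n\ge 0$ an integer. Let $M_n^{(k)}$ and $J_n^{(k)}$ be the $n$th higher order Mersenne and Jacobsthal numbers, respectively. Then: 1. $\left(M_n^{(k)}\right)^2=\frac{1}{2^k-1}\left(M_{2n}^{(k)}-2M_{n}^{(k)}\right)$. 2. If $n$ is even, then $M_n^{(k)}+J_n^{(k)}=2J_n^{(k)}$ if $k$ is even, and $M_n^{(k)}+J_n^{(k)}=\left(\frac{2^{k+1}}{2^k-1}\right)J_n^{(k)}$ if $k$ is odd. 3. If $n$ is odd, then $M_n^{(k)}+J_n^{(k)}=2J_n^{(k)}$ if $k$ is even, and $M_n^{(k)}+J_n^{(k)}=2\left(\frac{(2^k)^{n+1}-1}{4^k-1}\right)$ if $k$ is odd. 4. If $n$ is even, then $M_n^{(k)}J_n^{(k)}=\left(J_n^{(k)}\right)^2$ if $k$ is even, and $M_n^{(k)}J_n^{(k)}=\left(\frac{2^k+1}{2^k-1}\right)\left(J_n^{(k)}\right)^2$ if $k$ is odd. 5. If $n$ is odd, then $M_n^{(k)}J_n^{(k)}=\left(J_n^{(k)}\right)^2$ if $k$ is even, and $M_n^{(k)}J_n^{(k)}=M_n^{(2k)}$ if $k$ is odd.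
   Context: The Mersenne numbers $\{M_n\}_{n\ge 0}$ are defined by $M_0=0$, $M_1=1$, $M_{n+2}=3M_{n+1}-2M_n$, i.e. $M_n=2^n-1$. For a positive integer $k$, the higher order Mersenne numbers are $M_n^{(k)}=M_{kn}/M_k$ for $n=0,1,2,\dots$. The higher order Jacobsthal numbers are given (for positive integers $k$ and $n\ge 0$) by $$J_n^{(k)}=\frac{(2^k)^n-\left((-1)^k\right)^n}{2^k-(-1)^k}.$$ -}

module Defs where

open import Data.Nat.Base as ℕ using (ℕ; zero; suc)
import Data.Nat.Properties as ℕ
open import Data.Integer.Base hiding (suc)
open import Data.Integer.Properties
open import Data.Integer.Tactic.RingSolver using (solve-∀)
open import Data.Rational.Base as ℚ using (ℚ)
open import Data.Rational.Literals using (fromℤ)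
open import Data.Sum.Base using ([_,_]′)
open import Relation.Binary.PropositionalEquality

infixl 7 _÷ℤ_

-- The exact rational quotient of two integers.
_÷ℤ_ : (i j : ℤ) .{{_ : NonZero j}} → ℚ
i ÷ℤ j = fromℤ i ℚ.÷ fromℤ j

M : ℕ → ℤ
M zero          = 0ℤ
M (suc zero)    = 1ℤ
M (suc (suc n)) = + 3 * M (suc n) - + 2 * M n

M≡2^n-1 : ∀ n → M n ≡ (+ 2) ^ n - 1ℤ
M≡2^n-1 zero          = refl
M≡2^n-1 (suc zero)    = refl
M≡2^n-1 (suc (suc n)) =
  trans (cong₂ (λ a b → + 3 * a - + 2 * b) (M≡2^n-1 (suc n)) (M≡2^n-1 n))
        (step ((+ 2) ^ n))
  where
  step : ∀ x → + 3 * (+ 2 * x - 1ℤ) - + 2 * (x - 1ℤ) ≡ + 2 * (+ 2 * x) - 1ℤ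
  step = solve-∀

∣i^n∣≡∣i∣^n : ∀ i n → ∣ i ^ n ∣ ≡ ∣ i ∣ ℕ.^ n
∣i^n∣≡∣i∣^n i zero    = refl
∣i^n∣≡∣i∣^n i (suc n) = trans (abs-* i (i ^ n)) (cong (∣ i ∣ ℕ.*_) (∣i^n∣≡∣i∣^n i n))

b^k-u≢0 : ∀ b k .{{_ : ℕ.NonZero k}} {u} → ∣ u ∣ ≡ 1 →
          NonZero ((+ suc (suc b)) ^ k - u)
b^k-u≢0 b k {u} ∣u∣≡1 = ≢-nonZero λ eq →
  [ ℕ.≢-nonZero⁻¹ k , (λ ()) ]′
    (ℕ.m^n≡1⇒n≡0∨m≡1 (suc (suc b)) k
      (trans (sym (∣i^n∣≡∣i∣^n (+ suc (suc b)) k))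
             (trans (cong ∣_∣ (i-j≡0⇒i≡j ((+ suc (suc b)) ^ k) u eq)) ∣u∣≡1)))

2*k≢0 : ∀ k .{{_ : ℕ.NonZero k}} → ℕ.NonZero (2 ℕ.* k)
2*k≢0 k = ℕ.m*n≢0 2 k

2^k-1≢0 : ∀ k .{{_ : ℕ.NonZero k}} → NonZero ((+ 2) ^ k - 1ℤ)
2^k-1≢0 k = b^k-u≢0 0 k refl

4^k-1≢0 : ∀ k .{{_ : ℕ.NonZero k}} → NonZero ((+ 4) ^ k - 1ℤ)
4^k-1≢0 k = b^k-u≢0 2 k refl

2^k-[-1]^k≢0 : ∀ k .{{_ : ℕ.NonZero k}} → NonZero ((+ 2) ^ k - -1ℤ ^ k)
2^k-[-1]^k≢0 k = b^k-u≢0 0 k (trans (∣i^n∣≡∣i∣^n -1ℤ k) (ℕ.^-zeroˡ k))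

M≢0 : ∀ k .{{_ : ℕ.NonZero k}} → NonZero (M k)
M≢0 k = subst NonZero (sym (M≡2^n-1 k)) (2^k-1≢0 k)

M⁽_⁾ : (k : ℕ) .{{_ : ℕ.NonZero k}} → ℕ → ℚ
M⁽ k ⁾ n = M (k ℕ.* n) ÷ℤ M k
  where instance _ = M≢0 k

J⁽_⁾ : (k : ℕ) .{{_ : ℕ.NonZero k}} → ℕ → ℚ
J⁽ k ⁾ n = (((+ 2) ^ k) ^ n - (-1ℤ ^ k) ^ n) ÷ℤ ((+ 2) ^ k - -1ℤ ^ k)
  where instance _ = 2^k-[-1]^k≢0 k

{-# OPTIONS --safe #-}
module Submission where

-- With x = 2ᵏ and X = xⁿ, one has M = (X − 1)/(x − 1).  For even k, J = M.  For odd k,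
-- J = (X − (−1)ⁿ)/(x + 1), so for even n the two differ by the factor (x + 1)/(x − 1),
-- and the remaining claims compare numerators over (x − 1)² or (x − 1)(x + 1) = 4ᵏ − 1.

open import Defs
open import Data.Nat.Base as ℕ using (ℕ; zero; suc)
import Data.Nat.Properties as ℕ
open import Data.Nat.Divisibility using (_∣_; divides; _∣0; ∣-refl; ∣m∣n⇒∣m+n)
open import Data.Integer.Base as ℤ using (ℤ; +_; -[1+_]; 1ℤ; -1ℤ)
import Data.Integer.Properties as ℤ
open import Data.Integer.Tactic.RingSolver using (solve-∀)
open import Data.Rational.Base using (ℚ; _+_; _-_; _*_; -_; 1/_; 1ℚ)
open import Data.Rational.Literals using (fromℤ)
import Data.Rational.Properties as ℚ
import Data.Rational.Unnormalised.Base as ℚᵘ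
import Data.Rational.Unnormalised.Properties as ℚᵘ
open import Algebra.Bundles using (CommutativeMonoid)
open import Algebra.Properties.CommutativeSemigroup using (interchange; xy∙z≈y∙xz)
open import Data.Product.Base using (_×_; _,_)
open import Relation.Nullary.Negation.Core using (¬_; contradiction)
open import Relation.Binary.PropositionalEquality.Core using (_≡_; refl; sym; trans; cong; cong₂)
open import Relation.Binary.PropositionalEquality.Properties using (module ≡-Reasoning)

open ≡-Reasoning
open CommutativeMonoid ℚ.*-1-commutativeMonoid using () renaming (commutativeSemigroup to *-commutativeSemigroup)

-- Arithmetic of exact integer quotients in ℚ.

fromℤ-homo-+ : ∀ i j → fromℤ (i ℤ.+ j) ≡ fromℤ i + fromℤ j
-- Addition in ℚ normalises by a gcd and is stuck on variables. In ℚᵘ nothing is reduced, and the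
-- factors `1ℤ` in `numerators` are the denominators left by cross-multiplication.
fromℤ-homo-+ i j = ℚ.toℚᵘ-injective (ℚᵘ.≃-trans (ℚᵘ.*≡* (numerators i j))
                                     (ℚᵘ.≃-sym (ℚ.toℚᵘ-homo-+ (fromℤ i) (fromℤ j))))
  where
  numerators : ∀ i j → (i ℤ.+ j) ℤ.* 1ℤ ≡ (i ℤ.* 1ℤ ℤ.+ j ℤ.* 1ℤ) ℤ.* 1ℤ
  numerators = solve-∀

fromℤ-homo-* : ∀ i j → fromℤ (i ℤ.* j) ≡ fromℤ i * fromℤ j
fromℤ-homo-* i j = ℚ.toℚᵘ-injective (ℚᵘ.≃-sym (ℚ.toℚᵘ-homo-* (fromℤ i) (fromℤ j)))

-- Negation on ℚ is defined by cases on the numerator, so it computes only once `i` is split.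
fromℤ-homo‿- : ∀ i → fromℤ (ℤ.- i) ≡ - fromℤ i
fromℤ-homo‿- (+ zero)  = refl
fromℤ-homo‿- (+ suc _) = refl
fromℤ-homo‿- -[1+ _ ]  = refl

-- The nonzero proofs are irrelevant, so a denominator can be rewritten even though each side
-- carries its own proof.
÷ℤ-cong : ∀ {i i′ j j′} .{{_ : ℤ.NonZero j}} .{{_ : ℤ.NonZero j′}} →
          i ≡ i′ → j ≡ j′ → i ÷ℤ j ≡ i′ ÷ℤ j′
÷ℤ-cong refl refl = refl

÷ℤ-congˡ : ∀ j .{{_ : ℤ.NonZero j}} {i i′} → i ≡ i′ → i ÷ℤ j ≡ i′ ÷ℤ j
÷ℤ-congˡ j refl = refl

÷ℤ-inverse : ∀ i j .{{_ : ℤ.NonZero j}} → (i ÷ℤ j) * fromℤ j ≡ fromℤ i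
÷ℤ-inverse i j = begin
  fromℤ i * 1/ fromℤ j * fromℤ j   ≡⟨ ℚ.*-assoc (fromℤ i) (1/ fromℤ j) (fromℤ j) ⟩
  fromℤ i * (1/ fromℤ j * fromℤ j) ≡⟨ cong (fromℤ i *_) (ℚ.*-inverseˡ (fromℤ j)) ⟩
  fromℤ i * 1ℚ                     ≡⟨ ℚ.*-identityʳ (fromℤ i) ⟩
  fromℤ i                          ∎

-- Cancellation of a nonzero denominator: the product, sum and telescoping laws below are reduced by
-- it to identities with denominators cleared.
÷ℤ-unique : ∀ {q} i j .{{_ : ℤ.NonZero j}} → q * fromℤ j ≡ fromℤ i → q ≡ i ÷ℤ j
÷ℤ-unique {q} i j eq = begin
  q                            ≡⟨ ℚ.*-identityʳ q ⟨
  q * 1ℚ                       ≡⟨ cong (q *_) (ℚ.*-inverseʳ (fromℤ j)) ⟨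
  q * (fromℤ j * 1/ fromℤ j)   ≡⟨ ℚ.*-assoc q _ _ ⟨
  q * fromℤ j * 1/ fromℤ j     ≡⟨ cong (_* 1/ fromℤ j) eq ⟩
  i ÷ℤ j                       ∎

÷ℤ-homo-* : ∀ a b c d .{{_ : ℤ.NonZero b}} .{{_ : ℤ.NonZero d}} .{{_ : ℤ.NonZero (b ℤ.* d)}} →
            (a ÷ℤ b) * (c ÷ℤ d) ≡ (a ℤ.* c) ÷ℤ (b ℤ.* d)
÷ℤ-homo-* a b c d = ÷ℤ-unique (a ℤ.* c) (b ℤ.* d) (begin
  (a ÷ℤ b) * (c ÷ℤ d) * fromℤ (b ℤ.* d)           ≡⟨ cong ((a ÷ℤ b) * (c ÷ℤ d) *_) (fromℤ-homo-* b d) ⟩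
  (a ÷ℤ b) * (c ÷ℤ d) * (fromℤ b * fromℤ d)       ≡⟨ interchange *-commutativeSemigroup (a ÷ℤ b) _ _ _ ⟩
  ((a ÷ℤ b) * fromℤ b) * ((c ÷ℤ d) * fromℤ d)     ≡⟨ cong₂ _*_ (÷ℤ-inverse a b) (÷ℤ-inverse c d) ⟩
  fromℤ a * fromℤ c                               ≡⟨ fromℤ-homo-* a c ⟨
  fromℤ (a ℤ.* c)                                 ∎)

fromℤ-*-÷ℤ : ∀ a b c .{{_ : ℤ.NonZero c}} → fromℤ a * (b ÷ℤ c) ≡ (a ℤ.* b) ÷ℤ c
fromℤ-*-÷ℤ a b c = trans (sym (ℚ.*-assoc (fromℤ a) (fromℤ b) (1/ fromℤ c)))
                         (cong (_* 1/ fromℤ c) (sym (fromℤ-homo-* a b)))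

÷ℤ-homo-- : ∀ a b c .{{_ : ℤ.NonZero c}} → (a ÷ℤ c) - (b ÷ℤ c) ≡ (a ℤ.- b) ÷ℤ c
÷ℤ-homo-- a b c = begin
  (a ÷ℤ c) - (b ÷ℤ c)                   ≡⟨ cong (λ q → (a ÷ℤ c) + q) (ℚ.neg-distribˡ-* (fromℤ b) (1/ fromℤ c)) ⟩
  (a ÷ℤ c) + - fromℤ b * 1/ fromℤ c     ≡⟨ ℚ.*-distribʳ-+ (1/ fromℤ c) (fromℤ a) (- fromℤ b) ⟨
  (fromℤ a - fromℤ b) * 1/ fromℤ c      ≡⟨ cong (λ q → (fromℤ a + q) * 1/ fromℤ c) (fromℤ-homo‿- b) ⟨
  (fromℤ a + fromℤ (ℤ.- b)) * 1/ fromℤ c ≡⟨ cong (_* 1/ fromℤ c) (fromℤ-homo-+ a (ℤ.- b)) ⟨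
  (a ℤ.- b) ÷ℤ c                        ∎

-- The cross-multiplied numerator is left unreduced, so that later sums become polynomial identities
-- over ℤ for the ring solver.
÷ℤ-homo-+ : ∀ a b c d .{{_ : ℤ.NonZero b}} .{{_ : ℤ.NonZero d}} .{{_ : ℤ.NonZero (b ℤ.* d)}} →
            (a ÷ℤ b) + (c ÷ℤ d) ≡ (a ℤ.* d ℤ.+ c ℤ.* b) ÷ℤ (b ℤ.* d)
÷ℤ-homo-+ a b c d = ÷ℤ-unique (a ℤ.* d ℤ.+ c ℤ.* b) (b ℤ.* d) (begin
  ((a ÷ℤ b) + (c ÷ℤ d)) * fromℤ (b ℤ.* d)
    ≡⟨ ℚ.*-distribʳ-+ (fromℤ (b ℤ.* d)) (a ÷ℤ b) (c ÷ℤ d) ⟩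
  (a ÷ℤ b) * fromℤ (b ℤ.* d) + (c ÷ℤ d) * fromℤ (b ℤ.* d)
    ≡⟨ cong₂ _+_ (clear a b d) (trans (cong (λ e → (c ÷ℤ d) * fromℤ e) (ℤ.*-comm b d)) (clear c d b)) ⟩
  fromℤ (a ℤ.* d) + fromℤ (c ℤ.* b)
    ≡⟨ fromℤ-homo-+ (a ℤ.* d) (c ℤ.* b) ⟨
  fromℤ (a ℤ.* d ℤ.+ c ℤ.* b) ∎)
  where
  clear : ∀ a b d .{{_ : ℤ.NonZero b}} → (a ÷ℤ b) * fromℤ (b ℤ.* d) ≡ fromℤ (a ℤ.* d)
  clear a b d = begin
    (a ÷ℤ b) * fromℤ (b ℤ.* d)       ≡⟨ cong ((a ÷ℤ b) *_) (fromℤ-homo-* b d) ⟩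
    (a ÷ℤ b) * (fromℤ b * fromℤ d)   ≡⟨ ℚ.*-assoc (a ÷ℤ b) _ _ ⟨
    (a ÷ℤ b) * fromℤ b * fromℤ d     ≡⟨ cong (_* fromℤ d) (÷ℤ-inverse a b) ⟩
    fromℤ a * fromℤ d                ≡⟨ fromℤ-homo-* a d ⟨
    fromℤ (a ℤ.* d)                  ∎

÷ℤ-*-÷ℤ : ∀ a b c .{{_ : ℤ.NonZero b}} .{{_ : ℤ.NonZero c}} → (b ÷ℤ c) * (a ÷ℤ b) ≡ a ÷ℤ c
÷ℤ-*-÷ℤ a b c = ÷ℤ-unique a c (begin
  (b ÷ℤ c) * (a ÷ℤ b) * fromℤ c     ≡⟨ xy∙z≈y∙xz *-commutativeSemigroup (b ÷ℤ c) _ _ ⟩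
  (a ÷ℤ b) * ((b ÷ℤ c) * fromℤ c)   ≡⟨ cong ((a ÷ℤ b) *_) (÷ℤ-inverse b c) ⟩
  (a ÷ℤ b) * fromℤ b                ≡⟨ ÷ℤ-inverse a b ⟩
  fromℤ a                           ∎)

p+p≡2*p : ∀ p → p + p ≡ fromℤ (+ 2) * p
p+p≡2*p p = begin
  p + p               ≡⟨ cong₂ _+_ (ℚ.*-identityˡ p) (ℚ.*-identityˡ p) ⟨
  1ℚ * p + 1ℚ * p     ≡⟨ ℚ.*-distribʳ-+ p 1ℚ 1ℚ ⟨
  fromℤ (+ 2) * p     ∎

-- Integer powers and the parity of exponents.

^-distribʳ-* : ∀ i j n → (i ℤ.* j) ℤ.^ n ≡ i ℤ.^ n ℤ.* j ℤ.^ n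
^-distribʳ-* i j zero    = refl
^-distribʳ-* i j (suc n) = trans (cong (i ℤ.* j ℤ.*_) (^-distribʳ-* i j n))
                                 (interchange ℤ.*-commutativeSemigroup i j _ _)

i^2n≡i^n*i^n : ∀ i n → i ℤ.^ (2 ℕ.* n) ≡ i ℤ.^ n ℤ.* i ℤ.^ n
i^2n≡i^n*i^n i n = trans (ℤ.^-distribˡ-+-* i n (n ℕ.+ 0))
                         (cong (λ m → i ℤ.^ n ℤ.* i ℤ.^ m) (ℕ.+-identityʳ n))

i^[n+1]≡i*i^n : ∀ i n → i ℤ.^ (n ℕ.+ 1) ≡ i ℤ.* i ℤ.^ n
-- `n + 1` does not reduce for a variable `n`; once commuted it is `suc n` and the power unfolds by
-- definition.
i^[n+1]≡i*i^n i n = cong (i ℤ.^_) (ℕ.+-comm n 1)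

[-1]^even : ∀ {n} → 2 ∣ n → -1ℤ ℤ.^ n ≡ 1ℤ
[-1]^even (divides q refl) = begin
  -1ℤ ℤ.^ (q ℕ.* 2)  ≡⟨ cong (-1ℤ ℤ.^_) (ℕ.*-comm q 2) ⟩
  -- After regrouping the exponent, the base `-1ℤ ^ 2` evaluates to `1ℤ`.
  -1ℤ ℤ.^ (2 ℕ.* q)  ≡⟨ ℤ.^-*-assoc -1ℤ 2 q ⟨
  1ℤ ℤ.^ q           ≡⟨ ℤ.^-zeroˡ q ⟩
  1ℤ                 ∎

-- Oddness is a negated divisibility, so the induction descends by two: a divisor 2 of `n` would
-- also divide `n + 2`.
[-1]^odd : ∀ n → ¬ (2 ∣ n) → -1ℤ ℤ.^ n ≡ -1ℤ
[-1]^odd zero          odd = contradiction (2 ∣0) odd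
[-1]^odd (suc zero)    odd = refl
[-1]^odd (suc (suc n)) odd =
  cong (λ u → -1ℤ ℤ.* (-1ℤ ℤ.* u)) ([-1]^odd n (λ 2∣n → odd (∣m∣n⇒∣m+n ∣-refl 2∣n)))

difference-of-squares : ∀ i → (i ℤ.- 1ℤ) ℤ.* (i ℤ.+ 1ℤ) ≡ i ℤ.* i ℤ.- 1ℤ
difference-of-squares = solve-∀

2^k+1≢0 : ∀ k .{{_ : ℕ.NonZero k}} → ℤ.NonZero ((+ 2) ℤ.^ k ℤ.+ 1ℤ)
-- `i - -1ℤ` is `i + 1ℤ` by computation, so this is the case of base 2 and `u = -1ℤ`.
2^k+1≢0 k = b^k-u≢0 0 k { -1ℤ } refl

-- Closed forms in `x`, and the square of M.

module _ (k : ℕ) .{{_ : ℕ.NonZero k}} where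

  private
    x : ℤ
    x = (+ 2) ℤ.^ k

    instance
      2k≢0 = 2*k≢0 k
      x-1≢0 = 2^k-1≢0 k
      x+1≢0 = 2^k+1≢0 k
      4^k-1≢0′ = 4^k-1≢0 k
      [x-1][x-1]≢0 = ℤ.i*j≢0 (x ℤ.- 1ℤ) (x ℤ.- 1ℤ)
      [x-1][x+1]≢0 = ℤ.i*j≢0 (x ℤ.- 1ℤ) (x ℤ.+ 1ℤ)

  4^k≡2^k*2^k : (+ 4) ℤ.^ k ≡ x ℤ.* x
  4^k≡2^k*2^k = ^-distribʳ-* (+ 2) (+ 2) k

  M⁽⁾-closed : ∀ n → M⁽ k ⁾ n ≡ (x ℤ.^ n ℤ.- 1ℤ) ÷ℤ (x ℤ.- 1ℤ)
  -- The denominator of `M⁽ k ⁾` is `M k`, whose nonzero proof is not among the instances in scope.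
  M⁽⁾-closed n = ÷ℤ-cong {{M≢0 k}}
    (trans (M≡2^n-1 (k ℕ.* n)) (cong (ℤ._- 1ℤ) (sym (ℤ.^-*-assoc (+ 2) k n))))
    (M≡2^n-1 k)

  -- Keeping `u` and `v` as variables lets both equations be matched with `refl`; the parity cases
  -- then only supply the two signs.
  J⁽⁾-cong : ∀ n {u v} .{{_ : ℤ.NonZero (x ℤ.- u)}} → -1ℤ ℤ.^ k ≡ u → u ℤ.^ n ≡ v →
             J⁽ k ⁾ n ≡ (x ℤ.^ n ℤ.- v) ÷ℤ (x ℤ.- u)
  J⁽⁾-cong n refl refl = refl

  J⁽⁾≡M⁽⁾ : ∀ n → 2 ∣ k → J⁽ k ⁾ n ≡ M⁽ k ⁾ n
  J⁽⁾≡M⁽⁾ n 2∣k = trans (J⁽⁾-cong n ([-1]^even 2∣k) (ℤ.^-zeroˡ n)) (sym (M⁽⁾-closed n))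

  -- Here `u = -1ℤ` and `v = 1ℤ`; the denominator `x - -1ℤ` is already `x + 1ℤ` by computation.
  J⁽⁾-odd-even : ∀ n → ¬ (2 ∣ k) → 2 ∣ n → J⁽ k ⁾ n ≡ (x ℤ.^ n ℤ.- 1ℤ) ÷ℤ (x ℤ.+ 1ℤ)
  J⁽⁾-odd-even n k-odd 2∣n = J⁽⁾-cong n ([-1]^odd k k-odd) ([-1]^even 2∣n)

  J⁽⁾-odd-odd : ∀ n → ¬ (2 ∣ k) → ¬ (2 ∣ n) → J⁽ k ⁾ n ≡ (x ℤ.^ n ℤ.+ 1ℤ) ÷ℤ (x ℤ.+ 1ℤ)
  J⁽⁾-odd-odd n k-odd n-odd = J⁽⁾-cong n ([-1]^odd k k-odd) ([-1]^odd n n-odd)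

  M⁽⁾-double : ∀ n → M⁽ k ⁾ (2 ℕ.* n) ≡ (x ℤ.^ n ℤ.* x ℤ.^ n ℤ.- 1ℤ) ÷ℤ (x ℤ.- 1ℤ)
  M⁽⁾-double n = trans (M⁽⁾-closed (2 ℕ.* n)) (÷ℤ-congˡ (x ℤ.- 1ℤ) (cong (ℤ._- 1ℤ) (i^2n≡i^n*i^n x n)))

  -- Over the common denominator `(x - 1)²` this is `(X - 1)² = X² - 1 - 2(X - 1)`.
  M⁽⁾-square : ∀ n → M⁽ k ⁾ n * M⁽ k ⁾ n ≡
    (1ℤ ÷ℤ (x ℤ.- 1ℤ)) * (M⁽ k ⁾ (2 ℕ.* n) - fromℤ (+ 2) * M⁽ k ⁾ n)
  M⁽⁾-square n = begin
    M⁽ k ⁾ n * M⁽ k ⁾ n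
      ≡⟨ cong₂ _*_ (M⁽⁾-closed n) (M⁽⁾-closed n) ⟩
    ((X ℤ.- 1ℤ) ÷ℤ d) * ((X ℤ.- 1ℤ) ÷ℤ d)
      ≡⟨ ÷ℤ-homo-* (X ℤ.- 1ℤ) d (X ℤ.- 1ℤ) d ⟩
    ((X ℤ.- 1ℤ) ℤ.* (X ℤ.- 1ℤ)) ÷ℤ (d ℤ.* d)
      ≡⟨ ÷ℤ-congˡ (d ℤ.* d) (numerators X) ⟩
    -- The factor `1ℤ` is the numerator of `1 / (x - 1)`, kept so that the quotient splits into the
    -- required product.
    (1ℤ ℤ.* (X ℤ.* X ℤ.- 1ℤ ℤ.- + 2 ℤ.* (X ℤ.- 1ℤ))) ÷ℤ (d ℤ.* d)
      ≡⟨ ÷ℤ-homo-* 1ℤ d (X ℤ.* X ℤ.- 1ℤ ℤ.- + 2 ℤ.* (X ℤ.- 1ℤ)) d ⟨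
    (1ℤ ÷ℤ d) * ((X ℤ.* X ℤ.- 1ℤ ℤ.- + 2 ℤ.* (X ℤ.- 1ℤ)) ÷ℤ d)
      ≡⟨ cong ((1ℤ ÷ℤ d) *_) (÷ℤ-homo-- (X ℤ.* X ℤ.- 1ℤ) (+ 2 ℤ.* (X ℤ.- 1ℤ)) d) ⟨
    (1ℤ ÷ℤ d) * ((X ℤ.* X ℤ.- 1ℤ) ÷ℤ d - (+ 2 ℤ.* (X ℤ.- 1ℤ)) ÷ℤ d)
      ≡⟨ cong ((1ℤ ÷ℤ d) *_) (cong₂ _-_ (M⁽⁾-double n)
           (trans (cong (fromℤ (+ 2) *_) (M⁽⁾-closed n)) (fromℤ-*-÷ℤ (+ 2) (X ℤ.- 1ℤ) d))) ⟨
    (1ℤ ÷ℤ d) * (M⁽ k ⁾ (2 ℕ.* n) - fromℤ (+ 2) * M⁽ k ⁾ n) ∎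
    where
    d = x ℤ.- 1ℤ
    X = x ℤ.^ n
    numerators : ∀ X → (X ℤ.- 1ℤ) ℤ.* (X ℤ.- 1ℤ) ≡ 1ℤ ℤ.* (X ℤ.* X ℤ.- 1ℤ ℤ.- + 2 ℤ.* (X ℤ.- 1ℤ))
    numerators = solve-∀

  -- Sums and products of M and J, by parity.

  M⁽⁾+J⁽⁾-even : ∀ n → 2 ∣ k → M⁽ k ⁾ n + J⁽ k ⁾ n ≡ fromℤ (+ 2) * J⁽ k ⁾ n
  M⁽⁾+J⁽⁾-even n 2∣k = trans (cong (_+ J⁽ k ⁾ n) (sym (J⁽⁾≡M⁽⁾ n 2∣k))) (p+p≡2*p (J⁽ k ⁾ n))

  M⁽⁾*J⁽⁾-even : ∀ n → 2 ∣ k → M⁽ k ⁾ n * J⁽ k ⁾ n ≡ J⁽ k ⁾ n * J⁽ k ⁾ n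
  M⁽⁾*J⁽⁾-even n 2∣k = cong (_* J⁽ k ⁾ n) (sym (J⁽⁾≡M⁽⁾ n 2∣k))

  -- Both quotients have numerator `X - 1`, and `(x + 1) + (x - 1) = 2x` is the source of the power
  -- `2 ^ (k + 1)`.
  M⁽⁾+J⁽⁾-odd-even : ∀ n → ¬ (2 ∣ k) → 2 ∣ n →
    M⁽ k ⁾ n + J⁽ k ⁾ n ≡ ((+ 2) ℤ.^ (k ℕ.+ 1) ÷ℤ (x ℤ.- 1ℤ)) * J⁽ k ⁾ n
  M⁽⁾+J⁽⁾-odd-even n k-odd 2∣n = begin
    M⁽ k ⁾ n + J⁽ k ⁾ n
      ≡⟨ cong₂ _+_ (M⁽⁾-closed n) (J⁽⁾-odd-even n k-odd 2∣n) ⟩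
    ((X ℤ.- 1ℤ) ÷ℤ (x ℤ.- 1ℤ)) + ((X ℤ.- 1ℤ) ÷ℤ (x ℤ.+ 1ℤ))
      ≡⟨ ÷ℤ-homo-+ (X ℤ.- 1ℤ) (x ℤ.- 1ℤ) (X ℤ.- 1ℤ) (x ℤ.+ 1ℤ) ⟩
    ((X ℤ.- 1ℤ) ℤ.* (x ℤ.+ 1ℤ) ℤ.+ (X ℤ.- 1ℤ) ℤ.* (x ℤ.- 1ℤ)) ÷ℤ ((x ℤ.- 1ℤ) ℤ.* (x ℤ.+ 1ℤ))
      ≡⟨ ÷ℤ-congˡ ((x ℤ.- 1ℤ) ℤ.* (x ℤ.+ 1ℤ)) (numerators x X) ⟩
    (+ 2 ℤ.* x ℤ.* (X ℤ.- 1ℤ)) ÷ℤ ((x ℤ.- 1ℤ) ℤ.* (x ℤ.+ 1ℤ))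
      ≡⟨ ÷ℤ-homo-* (+ 2 ℤ.* x) (x ℤ.- 1ℤ) (X ℤ.- 1ℤ) (x ℤ.+ 1ℤ) ⟨
    ((+ 2 ℤ.* x) ÷ℤ (x ℤ.- 1ℤ)) * ((X ℤ.- 1ℤ) ÷ℤ (x ℤ.+ 1ℤ))
      ≡⟨ cong₂ _*_ (÷ℤ-congˡ (x ℤ.- 1ℤ) (i^[n+1]≡i*i^n (+ 2) k)) (J⁽⁾-odd-even n k-odd 2∣n) ⟨
    ((+ 2) ℤ.^ (k ℕ.+ 1) ÷ℤ (x ℤ.- 1ℤ)) * J⁽ k ⁾ n ∎
    where
    X = x ℤ.^ n
    numerators : ∀ x X → (X ℤ.- 1ℤ) ℤ.* (x ℤ.+ 1ℤ) ℤ.+ (X ℤ.- 1ℤ) ℤ.* (x ℤ.- 1ℤ)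
                       ≡ + 2 ℤ.* x ℤ.* (X ℤ.- 1ℤ)
    numerators = solve-∀

  [x-1][x+1]≡4^k-1 : (x ℤ.- 1ℤ) ℤ.* (x ℤ.+ 1ℤ) ≡ (+ 4) ℤ.^ k ℤ.- 1ℤ
  [x-1][x+1]≡4^k-1 = trans (difference-of-squares x) (cong (ℤ._- 1ℤ) (sym 4^k≡2^k*2^k))

  -- In `(X - 1)(x + 1) + (X + 1)(x - 1)` the linear terms cancel, leaving `2(xX - 1)` with
  -- `xX = x ^ (n + 1)`.
  M⁽⁾+J⁽⁾-odd-odd : ∀ n → ¬ (2 ∣ k) → ¬ (2 ∣ n) →
    M⁽ k ⁾ n + J⁽ k ⁾ n ≡ fromℤ (+ 2) * ((x ℤ.^ (n ℕ.+ 1) ℤ.- 1ℤ) ÷ℤ ((+ 4) ℤ.^ k ℤ.- 1ℤ))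
  M⁽⁾+J⁽⁾-odd-odd n k-odd n-odd = begin
    M⁽ k ⁾ n + J⁽ k ⁾ n
      ≡⟨ cong₂ _+_ (M⁽⁾-closed n) (J⁽⁾-odd-odd n k-odd n-odd) ⟩
    ((X ℤ.- 1ℤ) ÷ℤ (x ℤ.- 1ℤ)) + ((X ℤ.+ 1ℤ) ÷ℤ (x ℤ.+ 1ℤ))
      ≡⟨ ÷ℤ-homo-+ (X ℤ.- 1ℤ) (x ℤ.- 1ℤ) (X ℤ.+ 1ℤ) (x ℤ.+ 1ℤ) ⟩
    ((X ℤ.- 1ℤ) ℤ.* (x ℤ.+ 1ℤ) ℤ.+ (X ℤ.+ 1ℤ) ℤ.* (x ℤ.- 1ℤ)) ÷ℤ ((x ℤ.- 1ℤ) ℤ.* (x ℤ.+ 1ℤ))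
      ≡⟨ ÷ℤ-cong (numerators x X) [x-1][x+1]≡4^k-1 ⟩
    (+ 2 ℤ.* (x ℤ.* X ℤ.- 1ℤ)) ÷ℤ ((+ 4) ℤ.^ k ℤ.- 1ℤ)
      ≡⟨ fromℤ-*-÷ℤ (+ 2) (x ℤ.* X ℤ.- 1ℤ) ((+ 4) ℤ.^ k ℤ.- 1ℤ) ⟨
    fromℤ (+ 2) * ((x ℤ.* X ℤ.- 1ℤ) ÷ℤ ((+ 4) ℤ.^ k ℤ.- 1ℤ))
      ≡⟨ cong (fromℤ (+ 2) *_) (÷ℤ-congˡ ((+ 4) ℤ.^ k ℤ.- 1ℤ) (cong (ℤ._- 1ℤ) (i^[n+1]≡i*i^n x n))) ⟨
    fromℤ (+ 2) * ((x ℤ.^ (n ℕ.+ 1) ℤ.- 1ℤ) ÷ℤ ((+ 4) ℤ.^ k ℤ.- 1ℤ)) ∎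
    where
    X = x ℤ.^ n
    numerators : ∀ x X → (X ℤ.- 1ℤ) ℤ.* (x ℤ.+ 1ℤ) ℤ.+ (X ℤ.+ 1ℤ) ℤ.* (x ℤ.- 1ℤ)
                       ≡ + 2 ℤ.* (x ℤ.* X ℤ.- 1ℤ)
    numerators = solve-∀

  M⁽⁾*J⁽⁾-odd-even : ∀ n → ¬ (2 ∣ k) → 2 ∣ n →
    M⁽ k ⁾ n * J⁽ k ⁾ n ≡ ((x ℤ.+ 1ℤ) ÷ℤ (x ℤ.- 1ℤ)) * (J⁽ k ⁾ n * J⁽ k ⁾ n)
  M⁽⁾*J⁽⁾-odd-even n k-odd 2∣n = begin
    M⁽ k ⁾ n * J⁽ k ⁾ n        ≡⟨ cong (_* J⁽ k ⁾ n) M≡r*J ⟩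
    r * J⁽ k ⁾ n * J⁽ k ⁾ n    ≡⟨ ℚ.*-assoc r (J⁽ k ⁾ n) (J⁽ k ⁾ n) ⟩
    r * (J⁽ k ⁾ n * J⁽ k ⁾ n)  ∎
    where
    r = (x ℤ.+ 1ℤ) ÷ℤ (x ℤ.- 1ℤ)
    M≡r*J : M⁽ k ⁾ n ≡ r * J⁽ k ⁾ n
    M≡r*J = begin
      M⁽ k ⁾ n                                         ≡⟨ M⁽⁾-closed n ⟩
      -- M and J share the numerator here, so the ratio `r` of their denominators cancels `x + 1`
      -- and turns J into M.
      (x ℤ.^ n ℤ.- 1ℤ) ÷ℤ (x ℤ.- 1ℤ)                   ≡⟨ ÷ℤ-*-÷ℤ (x ℤ.^ n ℤ.- 1ℤ) (x ℤ.+ 1ℤ) (x ℤ.- 1ℤ) ⟨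
      r * ((x ℤ.^ n ℤ.- 1ℤ) ÷ℤ (x ℤ.+ 1ℤ))             ≡⟨ cong (r *_) (J⁽⁾-odd-even n k-odd 2∣n) ⟨
      r * J⁽ k ⁾ n                                     ∎

-- The product as a Mersenne quotient of order `2k`.

M⁽2*⁾-closed : ∀ k .{{_ : ℕ.NonZero k}} n →
  let instance
        2k≢0 = 2*k≢0 k
        d₄≢0 = 4^k-1≢0 k
  in M⁽ 2 ℕ.* k ⁾ n ≡ (((+ 2) ℤ.^ k) ℤ.^ n ℤ.* ((+ 2) ℤ.^ k) ℤ.^ n ℤ.- 1ℤ) ÷ℤ ((+ 4) ℤ.^ k ℤ.- 1ℤ)
-- The closed form is instantiated at order `2k`, hence outside the module that fixes `k`.
M⁽2*⁾-closed k n = trans (M⁽⁾-closed (2 ℕ.* k) n)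
  (÷ℤ-cong
    (cong (ℤ._- 1ℤ) (trans (cong (ℤ._^ n) (i^2n≡i^n*i^n (+ 2) k)) (^-distribʳ-* x x n)))
    -- `(+ 2) ^ 2` evaluates to `+ 4`, so regrouping the exponent `2 * k` gives `4 ^ k` directly.
    (cong (ℤ._- 1ℤ) (sym (ℤ.^-*-assoc (+ 2) 2 k))))
  where
  x = (+ 2) ℤ.^ k
  instance
    2k≢0 = 2*k≢0 k
    2^2k-1≢0 = 2^k-1≢0 (2 ℕ.* k)
    d₄≢0 = 4^k-1≢0 k

-- A difference of squares in the numerator and another in the denominator: `(X² - 1) / (x² - 1)`,
-- with `x² = 4 ^ k`.
M⁽⁾*J⁽⁾-odd-odd : ∀ k .{{_ : ℕ.NonZero k}} n → ¬ (2 ∣ k) → ¬ (2 ∣ n) →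
  let instance 2k≢0 = 2*k≢0 k in M⁽ k ⁾ n * J⁽ k ⁾ n ≡ M⁽ 2 ℕ.* k ⁾ n
M⁽⁾*J⁽⁾-odd-odd k n k-odd n-odd = begin
  M⁽ k ⁾ n * J⁽ k ⁾ n
    ≡⟨ cong₂ _*_ (M⁽⁾-closed k n) (J⁽⁾-odd-odd k n k-odd n-odd) ⟩
  ((X ℤ.- 1ℤ) ÷ℤ (x ℤ.- 1ℤ)) * ((X ℤ.+ 1ℤ) ÷ℤ (x ℤ.+ 1ℤ))
    ≡⟨ ÷ℤ-homo-* (X ℤ.- 1ℤ) (x ℤ.- 1ℤ) (X ℤ.+ 1ℤ) (x ℤ.+ 1ℤ) ⟩
  ((X ℤ.- 1ℤ) ℤ.* (X ℤ.+ 1ℤ)) ÷ℤ ((x ℤ.- 1ℤ) ℤ.* (x ℤ.+ 1ℤ))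
    ≡⟨ ÷ℤ-cong (difference-of-squares X) ([x-1][x+1]≡4^k-1 k) ⟩
  (X ℤ.* X ℤ.- 1ℤ) ÷ℤ ((+ 4) ℤ.^ k ℤ.- 1ℤ)
    ≡⟨ M⁽2*⁾-closed k n ⟨
  M⁽ 2 ℕ.* k ⁾ n ∎
  where
  x = (+ 2) ℤ.^ k
  X = x ℤ.^ n
  instance
    2k≢0 = 2*k≢0 k
    x-1≢0 = 2^k-1≢0 k
    x+1≢0 = 2^k+1≢0 k
    d₄≢0 = 4^k-1≢0 k
    [x-1][x+1]≢0 = ℤ.i*j≢0 (x ℤ.- 1ℤ) (x ℤ.+ 1ℤ)

theorem2p16 : (k : ℕ) .{{_ : ℕ.NonZero k}} (n : ℕ) →
  let instance
        2k≢0 = 2*k≢0 k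
        d₂≢0 = 2^k-1≢0 k
        d₄≢0 = 4^k-1≢0 k
  in
    (M⁽ k ⁾ n * M⁽ k ⁾ n ≡ (1ℤ ÷ℤ ((+ 2) ℤ.^ k ℤ.- 1ℤ)) * (M⁽ k ⁾ (2 ℕ.* n) - fromℤ (+ 2) * M⁽ k ⁾ n))
  × (2 ∣ n →
        (2 ∣ k → M⁽ k ⁾ n + J⁽ k ⁾ n ≡ fromℤ (+ 2) * J⁽ k ⁾ n)
      × (¬ (2 ∣ k) → M⁽ k ⁾ n + J⁽ k ⁾ n ≡ ((+ 2) ℤ.^ (k ℕ.+ 1) ÷ℤ ((+ 2) ℤ.^ k ℤ.- 1ℤ)) * J⁽ k ⁾ n))
  × (¬ (2 ∣ n) →
        (2 ∣ k → M⁽ k ⁾ n + J⁽ k ⁾ n ≡ fromℤ (+ 2) * J⁽ k ⁾ n)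
      × (¬ (2 ∣ k) → M⁽ k ⁾ n + J⁽ k ⁾ n ≡ fromℤ (+ 2) * ((((+ 2) ℤ.^ k) ℤ.^ (n ℕ.+ 1) ℤ.- 1ℤ) ÷ℤ ((+ 4) ℤ.^ k ℤ.- 1ℤ))))
  × (2 ∣ n →
        (2 ∣ k → M⁽ k ⁾ n * J⁽ k ⁾ n ≡ J⁽ k ⁾ n * J⁽ k ⁾ n)
      × (¬ (2 ∣ k) → M⁽ k ⁾ n * J⁽ k ⁾ n ≡ (((+ 2) ℤ.^ k ℤ.+ 1ℤ) ÷ℤ ((+ 2) ℤ.^ k ℤ.- 1ℤ)) * (J⁽ k ⁾ n * J⁽ k ⁾ n)))
  × (¬ (2 ∣ n) →
        (2 ∣ k → M⁽ k ⁾ n * J⁽ k ⁾ n ≡ J⁽ k ⁾ n * J⁽ k ⁾ n)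
      × (¬ (2 ∣ k) → M⁽ k ⁾ n * J⁽ k ⁾ n ≡ M⁽ 2 ℕ.* k ⁾ n))
theorem2p16 k n =
    M⁽⁾-square k n
  , (λ 2∣n → M⁽⁾+J⁽⁾-even k n , λ k-odd → M⁽⁾+J⁽⁾-odd-even k n k-odd 2∣n)
  , (λ n-odd → M⁽⁾+J⁽⁾-even k n , λ k-odd → M⁽⁾+J⁽⁾-odd-odd k n k-odd n-odd)
  , (λ 2∣n → M⁽⁾*J⁽⁾-even k n , λ k-odd → M⁽⁾*J⁽⁾-odd-even k n k-odd 2∣n)
  , (λ n-odd → M⁽⁾*J⁽⁾-even k n , λ k-odd → M⁽⁾*J⁽⁾-odd-odd k n k-odd n-odd)
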